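{- Let $k\ge 1$ be an integer. Given a regular $\underline{\mathcal{P}_k}$-independent code $X\subseteq A^*$, the four following conditions are equivalent: (i) $X$ is maximal in the family of $\underline{\mathcal{P}_k}$-independent codes. (ii) $X$ is a maximal code. (iii) $X$ is complete. (iv) $\mu(X)=1$.
   Context: $A$ is a finite alphabet with $|A|\ge 2$; $A^*$ is the free monoid over $A$ and $|w|$ is the length of $w$. A subset of $A^*$ is regular if it is recognized by a finite automaton. A set $X\subseteq A^*$ is a code if for all words $x_1,\dots,x_n,y_1,\dots,y_p\in X$, $x_1\cdots x_n=y_1\cdots y_p$ implies $n=p$ and $x_i=y_i$ for every $i$. $X$ is complete if every word of $A^*$ is a factor (contiguous subword) of some word in $X^*$, the submonoid generated by $X$. A code $X$ in a family of codes is maximal in that family if $X\subseteq Y$ with $Y$ in the family implies $Y=X$; a maximal code is a code maximal in the family of all codes over $A$. $\mu$ is the uniform Bernoulli measure: $\mu(X)=\sum_{w\in X}|A|^{ -|w|}$. For $w,w'\in A^*$, $w\wedge w'$ is their longest common prefix; $(w,w')\in\mathcal{P}_k$ iff $|w|+|w'|-2|w\wedge w'|\le k$, and $\underline{\mathcal{P}_k}=\mathcal{P}_k\setminus\{(w,w):w\in A^*\}$. For a relation $\tau\subseteq A^*\times A^*$, $\tau(X)=\{y:\exists x\in X,\ (x,y)\in\tau\}$, and $X$ is $\tau$-independent if $\tau(X)\cap X=\emptyset$. -}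

module Defs where

open import Data.Fin using (Fin)
open import Data.Fin.Properties using (inj⇒≟)
open import Data.Fin.Subset using (Subset; _∈_)
open import Data.Integer using (+_)
open import Data.List using (List; []; _∷_; length; concat; foldr)
open import Data.List.Relation.Binary.Infix.Heterogeneous using (Infix)
open import Data.List.Relation.Unary.All using (All)
open import Data.List.Relation.Unary.Unique.Propositional using (Unique)
open import Data.Nat as ℕ using (ℕ; z≤n; s≤s; NonZero; >-nonZero; _∸_)
open import Data.Nat.Properties using (m^n≢0; ≤-trans)
open import Data.Product using (Σ; ∃; ∃₂; _×_)
open import Data.Rational using (ℚ; 0ℚ; _/_; _+_; _-_; _<_; _≤_)
open import Function.Bundles using (_↔_)
open import Function.Properties.Inverse using (↔⇒↣)
open import Level using (0ℓ) renaming (suc to lsuc)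
open import Relation.Binary.Core using (Rel)
open import Relation.Binary.Definitions using (DecidableEquality)
open import Relation.Binary.PropositionalEquality using (_≡_; _≢_)
open import Relation.Nullary using (yes; no)
open import Relation.Unary using (Pred; Empty; _∩_; _⊆_; _≐_)

record Alphabet : Set₁ where
  field
    Letter : Set
    card   : ℕ
    enum   : Letter ↔ Fin card
    2≤card : 2 ℕ.≤ card

  instance
    card-nonZero : NonZero card
    card-nonZero = >-nonZero (≤-trans (s≤s z≤n) 2≤card)

  _≟_ : DecidableEquality Letter
  _≟_ = inj⇒≟ (↔⇒↣ enum)

-- Nondeterministic, with any number of initial and terminal states.
record Automaton (A : Set) : Set where
  field
    size     : ℕ
    initial  : Subset size
    terminal : Subset size
    edges    : Fin size → A → Subset size

  data Path : Fin size → List A → Fin size → Set where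
    []  : ∀ {p} → Path p [] p
    _∷_ : ∀ {p q r a w} → q ∈ edges p a → Path q w r → Path p (a ∷ w) r

  Recognized : Pred (List A) 0ℓ
  Recognized w = ∃₂ λ i t → i ∈ initial × t ∈ terminal × Path i w t

module Words (𝒜 : Alphabet) where

  open Alphabet 𝒜

  Word : Set
  Word = List Letter

  Language : Set₁
  Language = Pred Word 0ℓ

  Regular : Pred Language 0ℓ
  Regular X = Σ (Automaton Letter) λ M → X ≐ Automaton.Recognized M

  -- The lists may be empty: an empty and a nonempty factorization agree only
  -- if [] belongs to X, which already violates uniqueness for nonempty lists.
  Code : Pred Language 0ℓ
  Code X = ∀ {xs ys : List Word} → All X xs → All X ys →
           concat xs ≡ concat ys → xs ≡ ys

  infix 10 _⋆
  _⋆ : Language → Language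
  (X ⋆) w = ∃ λ (xs : List Word) → All X xs × concat xs ≡ w

  Complete : Pred Language 0ℓ
  Complete X = ∀ (w : Word) → ∃ λ z → (X ⋆) z × Infix _≡_ w z

  MaximalIn : Pred Language 0ℓ → Pred Language (lsuc 0ℓ)
  MaximalIn F X = F X × (∀ (Y : Language) → F Y → X ⊆ Y → Y ≐ X)

  MaximalCode : Pred Language (lsuc 0ℓ)
  MaximalCode = MaximalIn Code

  infixr 6 _∧_
  _∧_ : Word → Word → Word
  []      ∧ _       = []
  (_ ∷ _) ∧ []      = []
  (a ∷ u) ∧ (b ∷ v) with a ≟ b
  ... | yes _ = a ∷ (u ∧ v)
  ... | no  _ = []

  -- The subtraction never truncates: u ∧ v is at most as long as u and v.
  𝒫 : ℕ → Rel Word 0ℓ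
  𝒫 k u v = length u ℕ.+ length v ∸ 2 ℕ.* length (u ∧ v) ℕ.≤ k

  𝒫̲ : ℕ → Rel Word 0ℓ
  𝒫̲ k u v = 𝒫 k u v × u ≢ v

  image : Rel Word 0ℓ → Language → Language
  image τ X y = ∃ λ x → X x × τ x y

  Independent : Rel Word 0ℓ → Pred Language 0ℓ
  Independent τ X = Empty (image τ X ∩ X)

  IndependentCode : Rel Word 0ℓ → Pred Language 0ℓ
  IndependentCode τ X = Code X × Independent τ X

  weight : Word → ℚ
  weight w = (+ 1 / card ℕ.^ length w) {{m^n≢0 card (length w)}}

  mass : List Word → ℚ
  mass = foldr (λ w s → weight w + s) 0ℚ

  -- The sum of the nonnegative family (weight w), w ∈ X, equals r: that is,
  -- r is the supremum of its finite partial sums.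
  record HasMeasure (X : Language) (r : ℚ) : Set where
    field
      upper    : ∀ (ws : List Word) → Unique ws → All X ws → mass ws ≤ r
      approach : ∀ (ε : ℚ) → 0ℚ < ε →
                 ∃ λ (ws : List Word) → Unique ws × All X ws × r - ε < mass ws

{-# OPTIONS --safe #-}

-- If X is not complete, some word w is a factor of no word of X⋆.  Then
-- y = awa·bⁿ (a ≠ b letters, n large) cannot overlap itself, so X ∪ {y} is
-- still a code; and since every word at prefix distance at most k from y has
-- awa as a prefix, X ∪ {y} is still independent.  Hence both maximality
-- conditions imply completeness.
--
-- If X is regular and complete, an automaton for X⋆ provides finitely many
-- contexts (u , v) such that every word w has some u w v in X⋆.  So the mass
-- of X⋆ restricted to words of length < n grows linearly with n.  If all finite
-- subsets of X had mass at most 1 - ε, that mass would be bounded by the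
-- geometric series 1 / ε; hence the measure of X is at least 1, and it is at
-- most 1 by the Kraft–McMillan inequality.  The same inequality shows that no
-- word can be added to a code of measure 1.
--
-- Membership in X, in X⋆ and in the set of factors of X⋆ is decidable because X
-- is regular, so no classical principle is needed.

module Submission where

open import Defs
open import Algebra.Bundles using (CommutativeRing)
open import Data.Fin as Fin using (Fin; fromℕ<; toℕ)
import Data.Fin.Properties as Fin
open import Data.Fin.Subset as Subset using (Subset)
open import Data.Fin.Subset.Properties using (_∈?_)
open import Data.Integer as ℤ using (+[1+_]; +≤+)
import Data.Integer.Properties as ℤ
open import Data.List using (List; []; _∷_; _++_; _∷ʳ_; [_]; length; concat; map; filter; take; drop; replicate; cartesianProduct; cartesianProductWith; allFin)
open import Data.List.Membership.Propositional using (_∈_; find; lose)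
open import Data.List.Membership.Propositional.Properties using (∈-∃++; ∈-++⁺ˡ; ∈-++⁺ʳ; ∈-++⁻; ∈-map⁺; ∈-map⁻; ∈-filter⁺; ∈-filter⁻; ∈-cartesianProduct⁺; ∈-cartesianProduct⁻; ∈-cartesianProductWith⁺; ∈-cartesianProductWith⁻; ∈-allFin)
open import Data.List.Properties using (++-assoc; ++-identityʳ; ++-cancelˡ; ++-cancelʳ; ++-conicalˡ; ++-conicalʳ; ∷-injective; map-++; concat-++; concat-map-[_]; length-++; length-map; length-drop; length-tabulate; length-replicate; take++drop≡id)
open import Data.List.Relation.Binary.Infix.Heterogeneous using (Infix; MkView; toView; fromView)
open import Data.List.Relation.Binary.Pointwise using (Pointwise-≡⇒≡; ≡⇒Pointwise-≡)
open import Data.List.Relation.Binary.Subset.Propositional renaming (_⊆_ to _⊆ˡ_)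
open import Data.List.Relation.Unary.All as All using (All; []; _∷_)
import Data.List.Relation.Unary.All.Properties as All
open import Data.List.Relation.Unary.AllPairs using ([]; _∷_)
open import Data.List.Relation.Unary.Any as Any using (here; there)
open import Data.List.Relation.Unary.Unique.Propositional using (Unique)
import Data.List.Relation.Unary.Unique.Propositional.Properties as Unique
open import Data.Nat as ℕ using (ℕ; zero; suc; _+_; _*_; _∸_; _≤_; _<_; _≤?_; s≤s; z≤n; NonZero)
open import Data.Nat.Coprimality as Coprimality using (1-coprimeTo)
open import Data.Nat.Induction using (<-wellFounded)
open import Data.Nat.Properties as ℕ using (m^n≢0)
open import Data.Nat.Solver using (module +-*-Solver)
open import Data.Product using (∃; ∃₂; _×_; _,_; proj₁; proj₂)
open import Data.Rational as ℚ using (ℚ; mkℚ; 0ℚ; 1ℚ; *≤*; *<*)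
import Data.Rational.Properties as ℚ
import Data.Rational.Solver as ℚ
open import Data.Sum using (_⊎_; inj₁; inj₂)
open import Data.Vec using (tabulate)
open import Data.Vec.Properties using (lookup∘tabulate; lookup⇒[]=; []=⇒lookup)
open import Function using (_∘_; id)
open import Function.Bundles using (_⇔_; mk⇔; Inverse)
open import Induction.WellFounded using (Acc; acc)
open import Relation.Binary.PropositionalEquality hiding ([_])
open import Relation.Nullary using (¬_; Dec; yes; no; contradiction; does; _×-dec_; _⊎-dec_)
open import Relation.Nullary.Decidable using (dec-true; map′)
open import Relation.Unary using (Decidable; _⊆_; _∪_; ｛_｝)
open import Algebra.Properties.Semiring.Exp (CommutativeRing.semiring ℚ.+-*-commutativeRing) using (_^_; ^-homo-*)
open import Algebra.Properties.Semiring.Mult (CommutativeRing.semiring ℚ.+-*-commutativeRing) using (×-homo-+; ×-assocˡ; ×-comm-*; ×-assoc-*) renaming (_×_ to _·_)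

-- Combinatorics on words

module _ {A : Set} where

  Factor : List A → List A → Set
  Factor w z = ∃₂ λ u v → z ≡ u ++ w ++ v

  Infix⇒Factor : ∀ {w z} → Infix _≡_ w z → Factor w z
  Infix⇒Factor i with toView i
  ... | MkView u w≈ v with refl ← Pointwise-≡⇒≡ w≈ = u , v , refl

  Factor⇒Infix : ∀ {w z} → Factor w z → Infix _≡_ w z
  Factor⇒Infix (u , v , refl) = fromView (MkView u (≡⇒Pointwise-≡ refl) v)

  Factor-trans : ∀ {w y z} → Factor w y → Factor y z → Factor w z
  Factor-trans {w} (u , v , refl) (u′ , v′ , refl) = u′ ++ u , v ++ v′ , (begin
    u′ ++ (u ++ w ++ v) ++ v′   ≡⟨ cong (u′ ++_) (++-assoc u (w ++ v) v′) ⟩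
    u′ ++ u ++ (w ++ v) ++ v′   ≡⟨ cong (λ t → u′ ++ u ++ t) (++-assoc w v v′) ⟩
    u′ ++ u ++ w ++ v ++ v′     ≡⟨ ++-assoc u′ u _ ⟨
    (u′ ++ u) ++ w ++ v ++ v′   ∎)
    where open ≡-Reasoning

  -- Levi's lemma. It replaces all bookkeeping of positions in the arguments on overlaps.
  equidivisible : ∀ (u v : List A) {x y} → u ++ x ≡ v ++ y →
    (∃ λ t → v ≡ u ++ t × x ≡ t ++ y) ⊎ (∃ λ t → u ≡ v ++ t × y ≡ t ++ x)
  equidivisible []      v       eq = inj₁ (v , refl , eq)
  equidivisible (a ∷ u) []      eq = inj₂ (a ∷ u , refl , sym eq)
  equidivisible (a ∷ u) (b ∷ v) eq with refl , eq′ ← ∷-injective eq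
    with equidivisible u v eq′
  ... | inj₁ (t , refl , e) = inj₁ (t , refl , e)
  ... | inj₂ (t , refl , e) = inj₂ (t , refl , e)

  Factor-length : ∀ {w z} → Factor w z → length w ≤ length z
  Factor-length {w} (u , v , refl) = begin
    length w                   ≤⟨ ℕ.m≤m+n _ _ ⟩
    length w + length v        ≡⟨ length-++ w ⟨
    length (w ++ v)            ≤⟨ ℕ.m≤n+m _ _ ⟩
    length u + length (w ++ v) ≡⟨ length-++ u ⟨
    length (u ++ w ++ v)       ∎
    where open ℕ.≤-Reasoning

  longer-prefix : ∀ (x : A) t u {v} → u ≢ (x ∷ t) ++ u ++ v
  longer-prefix x t u {v} eq = ℕ.<-irrefl (cong length eq) (s≤s (Factor-length (t , v , refl)))

  -- The suffix b of y is also a prefix of y, since it is no longer than y; r and s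
  -- only spare the cancellation.
  Unbordered : List A → Set
  Unbordered y = ∀ {t b r s} → y ≡ t ++ b → b ++ r ≡ y ++ s → t ≡ [] ⊎ b ≡ []

  -- The two copies of `y` start `length t` letters apart. Either `y` fits into `t`, hence into
  -- `u ++ t`, or the copies overlap in a border; an empty overlap makes `t` equal to `y`, which is
  -- excluded too. In `++-cut`, `u` is the shorter left factor and `u ++ t` the longer one.
  first-occurrence : ∀ {y} → Unbordered y → ∀ t {u r s} → ¬ Factor y (u ++ t) →
    y ++ r ≡ t ++ y ++ s → t ≡ []
  first-occurrence {y} unb t {u} ∤ut eq with equidivisible y t eq
  ... | inj₁ (t₁ , refl , _) = contradiction (u , t₁ , refl) ∤ut
  ... | inj₂ (t₁ , y≡ , eq′) with unb y≡ (sym eq′)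
  ...   | inj₁ t≡[] = t≡[]
  ...   | inj₂ refl = contradiction
    (u , [] , cong (u ++_) (trans (sym (++-identityʳ t)) (trans (sym y≡) (sym (++-identityʳ y))))) ∤ut

  -- By Levi's lemma one of `u`, `v` extends the other by some `t`, and `first-occurrence` makes `t`
  -- empty.
  ++-cut : ∀ {y} → Unbordered y → ∀ u v {r s} → ¬ Factor y u → ¬ Factor y v →
    u ++ y ++ r ≡ v ++ y ++ s → u ≡ v × r ≡ s
  ++-cut {y} unb u v {r} {s} ∤u ∤v eq with equidivisible u v eq
  ... | inj₁ (t , refl , e) with refl ← first-occurrence unb t {u} ∤v e =
    sym (++-identityʳ u) , ++-cancelˡ y r s e
  ... | inj₂ (t , refl , e) with refl ← first-occurrence unb t {v} ∤u e =
    ++-identityʳ v , sym (++-cancelˡ y s r e)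

  module _ {a b : A} (a≢b : a ≢ b) where

    private
      no-b-suffix : ∀ d m {m′} → d ∷ʳ a ≡ m ++ m′ → All (_≡ b) m′ → m′ ≡ []
      no-b-suffix d m {m′} eq all-b with equidivisible d m eq
      ... | inj₁ ([]     , _ , refl) with b≡ ∷ [] ← all-b = contradiction b≡ a≢b
      ... | inj₁ (_ ∷ t  , _ , e)    = ++-conicalʳ t m′ (sym (∷-injective e .proj₂))
      ... | inj₂ (t , _ , refl) with b≡ ∷ [] ← All.++⁻ʳ t all-b = contradiction b≡ a≢b

    padded : List A → ℕ → List A
    padded w n = ((a ∷ w) ∷ʳ a) ++ replicate n b

    -- If a shifted copy of awabⁿ starts inside awa, then the last letter of its awa
    -- falls into the original bⁿ, which is longer than awa.
    padded-unbordered : ∀ w {n} → length ((a ∷ w) ∷ʳ a) < n → Unbordered (padded w n)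
    padded-unbordered w {n} ℓ<n {t} {β} {r} {s} y≡ eq
      with equidivisible ((a ∷ w) ∷ʳ a) t y≡
    -- The shifted copy starts inside the block of `b`, so the border consists of letters `b`; a
    -- nonempty border would begin with `a`.
    ... | inj₁ (m , _ , e) = inj₂ (β-empty β eq (All.++⁻ʳ m
      (subst (All (_≡ b)) e (All.replicate⁺ n refl))))
      where
      β-empty : ∀ β → β ++ r ≡ padded w n ++ s → All (_≡ b) β → β ≡ []
      β-empty []      _ _        = refl
      β-empty (c ∷ β) e′ (refl ∷ _) with refl ← ∷-injective e′ .proj₁ = contradiction refl a≢b
    ... | inj₂ (m , c≡ , refl) with t
    ...   | [] = inj₁ refl
    ...   | x ∷ t′ with equidivisible m ((a ∷ w) ∷ʳ a)
                        (trans (sym (++-assoc m _ r)) (trans eq (++-assoc ((a ∷ w) ∷ʳ a) _ s)))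
    ...     | inj₂ (m′ , refl , _) = contradiction c≡ (longer-prefix x t′ ((a ∷ w) ∷ʳ a))
    ...     | inj₁ (m′ , c≡′ , e) with equidivisible (replicate n b) m′ e
    ...       | inj₁ (m″ , refl , _) = contradiction
      (subst (_≤ _) (length-replicate n) (Factor-length (m , m″ , c≡′))) (ℕ.<⇒≱ ℓ<n)
    -- Here `m′` is a suffix of `awa` made of letters `b`, hence empty, and `awa` would equal its
    -- own proper suffix `m`.
    ...       | inj₂ (m″ , e″ , _)
      with refl ← no-b-suffix (a ∷ w) m c≡′ (All.++⁻ˡ m′ (subst (All (_≡ b)) e″ (All.replicate⁺ n refl)))
      = contradiction
          (trans c≡ (cong ((x ∷ t′) ++_)
            (trans (sym (++-identityʳ m)) (trans (sym c≡′) (sym (++-identityʳ _))))))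
          (longer-prefix x t′ ((a ∷ w) ∷ʳ a))

-- Automata

module _ {n} {P : Fin n → Set} (P? : Decidable P) where

  comprehension : Subset n
  comprehension = tabulate (λ i → does (P? i))

  ∈-comprehension⁺ : ∀ {i} → P i → i Subset.∈ comprehension
  ∈-comprehension⁺ {i} p = lookup⇒[]= i _ (trans (lookup∘tabulate _ i) (dec-true (P? i) p))

  ∈-comprehension⁻ : ∀ {i} → i Subset.∈ comprehension → P i
  ∈-comprehension⁻ {i} i∈ with P? i | trans (sym (lookup∘tabulate (λ i → does (P? i)) i)) ([]=⇒lookup i∈)
  ... | yes p | _ = p

module _ {A : Set} (M : Automaton A) where
  open Automaton M

  path-++ : ∀ {p q r u v} → Path p u q → Path q v r → Path p (u ++ v) r
  path-++ []       σ = σ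
  path-++ (e ∷ π) σ = e ∷ path-++ π σ

  path-split : ∀ {p r} u {v} → Path p (u ++ v) r → ∃ λ q → Path p u q × Path q v r
  path-split []      π = _ , [] , π
  path-split (_ ∷ u) (e ∷ π) with q , σ , τ ← path-split u π = q , e ∷ σ , τ

  path? : ∀ p w r → Dec (Path p w r)
  path? p []      r = map′ (λ { refl → [] }) (λ { [] → refl }) (p Fin.≟ r)
  path? p (a ∷ w) r = map′ (λ { (_ , e , π) → e ∷ π }) (λ { (e ∷ π) → _ , e , π })
    (Fin.any? λ q → q ∈? edges p a ×-dec path? q w r)

  recognized? : Decidable Recognized
  recognized? w = Fin.any? λ i → Fin.any? λ t →
    i ∈? initial ×-dec t ∈? terminal ×-dec path? i w t

  private
    -- The prefixes of lengths 0 to `size` lead to `suc size` states, two of which agree; the loop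
    -- between them is removed.
    cut-cycle : ∀ {p w r} → Path p w r → size < length w →
      ∃ λ w′ → length w′ < length w × Path p w′ r
    cut-cycle {p} {w} {r} π long = shorter
      where
      split : ∀ j → ∃ λ q → Path p (take j w) q × Path q (drop j w) r
      split j = path-split (take j w) (subst (λ w → Path p w r) (sym (take++drop≡id j w)) π)
      state : Fin (suc size) → Fin size
      state j = split (toℕ j) .proj₁
      shorter : _
      shorter with i , j , i<j , eq ← Fin.pigeonhole (ℕ.n<1+n size) state
        with split (toℕ i) | split (toℕ j) | eq
      ... | _ , σ , _ | _ , _ , τ | refl = take (toℕ i) w ++ drop (toℕ j) w , (begin-strict
        length (take (toℕ i) w ++ drop (toℕ j) w)         ≡⟨ length-++ (take (toℕ i) w) ⟩
        length (take (toℕ i) w) + length (drop (toℕ j) w) <⟨ ℕ.+-monoʳ-< _ shorter-drop ⟩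
        length (take (toℕ i) w) + length (drop (toℕ i) w) ≡⟨ length-++ (take (toℕ i) w) ⟨
        length (take (toℕ i) w ++ drop (toℕ i) w)         ≡⟨ cong length (take++drop≡id (toℕ i) w) ⟩
        length w                                           ∎) , path-++ σ τ
        where
        open ℕ.≤-Reasoning
        shorter-drop : length (drop (toℕ j) w) < length (drop (toℕ i) w)
        -- Strictness of the truncated subtraction uses that `j` is at most `size`, hence at most
        -- the length of `w`.
        shorter-drop rewrite length-drop (toℕ i) w | length-drop (toℕ j) w =
          ℕ.∸-monoʳ-< i<j (ℕ.≤-trans (Fin.toℕ≤pred[n] j) (ℕ.<⇒≤ long))

    shorten-acc : ∀ {p w r} → Acc _<_ (length w) → Path p w r →
      ∃ λ w′ → length w′ ≤ size × Path p w′ r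
    shorten-acc {w = w} (acc rec) π with length w ≤? size
    ... | yes short = w , short , π
    ... | no  long with w′ , w′<w , π′ ← cut-cycle π (ℕ.≰⇒> long) = shorten-acc (rec w′<w) π′

  -- Applied to the outer parts of an accepting path, this bounds the contexts of a factor of `X ⋆`.
  shorten : ∀ {p w r} → Path p w r → ∃ λ w′ → length w′ ≤ size × Path p w′ r
  shorten = shorten-acc (<-wellFounded _)

  -- A path may jump from a terminal state to an initial one, the jump being
  -- merged into the next edge.
  data Step⁺ (p : Fin size) (a : A) (q : Fin size) : Set where
    step : q Subset.∈ edges p a → Step⁺ p a q
    jump : ∀ {i} → p Subset.∈ terminal → i Subset.∈ initial → q Subset.∈ edges i a → Step⁺ p a q

  step⁺? : ∀ p a → Decidable (Step⁺ p a)
  step⁺? p a q = map′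
    (λ { (inj₁ e) → step e ; (inj₂ (t , _ , i , e)) → jump t i e })
    (λ { (step e) → inj₁ e ; (jump t i e) → inj₂ (t , _ , i , e) })
    (q ∈? edges p a ⊎-dec (p ∈? terminal ×-dec Fin.any? λ i → i ∈? initial ×-dec q ∈? edges i a))

  -- Recognizes the products of one or more recognized words. The states stay the same, so `shorten`
  -- keeps the bound `size`.
  plus : Automaton A
  plus = record
    { size = size ; initial = initial ; terminal = terminal
    ; edges = λ p a → comprehension (step⁺? p a) }

-- Growth estimates in ℚ

*-monoˡ-≤ : ∀ {p q r} → 0ℚ ℚ.≤ r → p ℚ.≤ q → r ℚ.* p ℚ.≤ r ℚ.* q
*-monoˡ-≤ {r = r} 0≤r = ℚ.*-monoˡ-≤-nonNeg r {{ℚ.nonNegative 0≤r}}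

*-mono-≤ : ∀ {p q r s} → 0ℚ ℚ.≤ p → 0ℚ ℚ.≤ s → p ℚ.≤ q → r ℚ.≤ s → p ℚ.* r ℚ.≤ q ℚ.* s
*-mono-≤ {s = s} 0≤p 0≤s p≤q r≤s = ℚ.≤-trans (*-monoˡ-≤ 0≤p r≤s)
  (ℚ.*-monoʳ-≤-nonNeg s {{ℚ.nonNegative 0≤s}} p≤q)

0≤* : ∀ {p q} → 0ℚ ℚ.≤ p → 0ℚ ℚ.≤ q → 0ℚ ℚ.≤ p ℚ.* q
0≤* {p} {q} 0≤p 0≤q = subst (ℚ._≤ p ℚ.* q) (ℚ.*-zeroʳ p) (*-monoˡ-≤ 0≤p 0≤q)

0<* : ∀ {p q} → 0ℚ ℚ.< p → 0ℚ ℚ.< q → 0ℚ ℚ.< p ℚ.* q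
0<* {p} {q} 0<p 0<q = subst (ℚ._< p ℚ.* q) (ℚ.*-zeroʳ p) (ℚ.*-monoʳ-<-pos p {{ℚ.positive 0<p}} 0<q)

0≤+ : ∀ {p q} → 0ℚ ℚ.≤ p → 0ℚ ℚ.≤ q → 0ℚ ℚ.≤ p ℚ.+ q
0≤+ = ℚ.+-mono-≤

0≤1 : 0ℚ ℚ.≤ 1ℚ
0≤1 = ℚ.<⇒≤ (ℚ.positive⁻¹ 1ℚ)

^-nonNeg : ∀ {p} → 0ℚ ℚ.≤ p → ∀ n → 0ℚ ℚ.≤ p ^ n
^-nonNeg 0≤p zero    = 0≤1
^-nonNeg 0≤p (suc n) = 0≤* 0≤p (^-nonNeg 0≤p n)

·-nonNeg : ∀ n {p} → 0ℚ ℚ.≤ p → 0ℚ ℚ.≤ n · p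
·-nonNeg zero    0≤p = ℚ.≤-refl
·-nonNeg (suc n) 0≤p = 0≤+ 0≤p (·-nonNeg n 0≤p)

·-monoˡ-≤ : ∀ {m n p} → 0ℚ ℚ.≤ p → m ≤ n → m · p ℚ.≤ n · p
·-monoˡ-≤ {n = n} 0≤p z≤n = ·-nonNeg n 0≤p
·-monoˡ-≤ {p = p} 0≤p (s≤s m≤n) = ℚ.+-monoʳ-≤ p (·-monoˡ-≤ 0≤p m≤n)

·-monoʳ-≤ : ∀ n {p q} → p ℚ.≤ q → n · p ℚ.≤ n · q
·-monoʳ-≤ zero    p≤q = ℚ.≤-refl
·-monoʳ-≤ (suc n) p≤q = ℚ.+-mono-≤ p≤q (·-monoʳ-≤ n p≤q)

·-monoʳ-< : ∀ n {p q} → p ℚ.< q → suc n · p ℚ.< suc n · q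
·-monoʳ-< n p<q = ℚ.+-mono-<-≤ p<q (·-monoʳ-≤ n (ℚ.<⇒≤ p<q))

·≡·1* : ∀ n p → n · p ≡ n · 1ℚ ℚ.* p
·≡·1* n p = sym (trans (×-assoc-* n 1ℚ p) (cong (n ·_) (ℚ.*-identityˡ p)))

fromℕ : ℕ → ℚ
fromℕ n = mkℚ (ℤ.+ n) 0 (Coprimality.sym (1-coprimeTo n))

·1≡fromℕ : ∀ n → n · 1ℚ ≡ fromℕ n
·1≡fromℕ zero = refl
·1≡fromℕ (suc n) rewrite ·1≡fromℕ n = trans
  (cong (ℚ._/ 1) (cong (ℤ._+_ (ℤ.+ 1)) (ℤ.*-identityʳ (ℤ.+ n))))
  (ℚ.↥p/↧p≡p (fromℕ (suc n)))

-- Written in lowest terms, so that it is definitionally the inverse of `fromℕ (suc n)` and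
-- `ℚ.*-inverseʳ` applies.
1/suc : ℕ → ℚ
1/suc n = mkℚ (ℤ.+ 1) n (1-coprimeTo (suc n))

1/≡1/suc : ∀ n → ℤ.+ 1 ℚ./ suc n ≡ 1/suc n
1/≡1/suc n = ℚ.↥p/↧p≡p (1/suc n)

suc·1/suc : ∀ n → suc n · 1/suc n ≡ 1ℚ
suc·1/suc n = begin
  suc n · 1/suc n               ≡⟨ ·≡·1* (suc n) (1/suc n) ⟩
  suc n · 1ℚ ℚ.* 1/suc n        ≡⟨ cong (ℚ._* 1/suc n) (·1≡fromℕ (suc n)) ⟩
  fromℕ (suc n) ℚ.* 1/suc n     ≡⟨ ℚ.*-inverseʳ (fromℕ (suc n)) ⟩
  1ℚ                            ∎
  where open ≡-Reasoning

archimedean : ∀ b {p} → 0ℚ ℚ.< p → ∃ λ n → b · 1ℚ ℚ.< n · p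
archimedean b {mkℚ (ℤ.+ zero)   d _} (*<* (ℤ.+<+ ()))
-- Since `p` is at least `1/suc d`, `suc d` copies of `p` reach 1, and `suc b` times as many exceed
-- `b`.
archimedean b {p@(mkℚ +[1+ n ] d _)} _ = suc b * suc d , (begin-strict
  b · 1ℚ                    ≡⟨ ℚ.+-identityˡ _ ⟨
  0ℚ ℚ.+ b · 1ℚ             <⟨ ℚ.+-monoˡ-< (b · 1ℚ) (ℚ.positive⁻¹ 1ℚ) ⟩
  suc b · 1ℚ                ≡⟨ cong (suc b ·_) (suc·1/suc d) ⟨
  suc b · (suc d · 1/suc d) ≤⟨ ·-monoʳ-≤ (suc b) (·-monoʳ-≤ (suc d) 1/suc≤p) ⟩
  suc b · (suc d · p)       ≡⟨ ×-assocˡ p (suc b) (suc d) ⟩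
  (suc b * suc d) · p       ∎)
  where
  open ℚ.≤-Reasoning
  1/suc≤p : 1/suc d ℚ.≤ p
  1/suc≤p = *≤* (ℤ.*-monoʳ-≤-nonNeg (ℤ.+ suc d) {ℤ.+ 1} {+[1+ n ]} (+≤+ (s≤s z≤n)))

-- Bernoulli's inequality; the induction step drops the nonnegative term `δ ℚ.* (m · δ)`.
bernoulli : ∀ {δ} → 0ℚ ℚ.≤ δ → ∀ m → 1ℚ ℚ.+ m · δ ℚ.≤ (1ℚ ℚ.+ δ) ^ m
bernoulli 0≤δ zero = ℚ.≤-refl
bernoulli {δ} 0≤δ (suc m) = begin
  1ℚ ℚ.+ (δ ℚ.+ m · δ)                    ≡⟨ ℚ.+-identityʳ _ ⟨
  1ℚ ℚ.+ (δ ℚ.+ m · δ) ℚ.+ 0ℚ             ≤⟨ ℚ.+-monoʳ-≤ (1ℚ ℚ.+ (δ ℚ.+ m · δ)) (0≤* 0≤δ (·-nonNeg m 0≤δ)) ⟩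
  1ℚ ℚ.+ (δ ℚ.+ m · δ) ℚ.+ δ ℚ.* (m · δ)  ≡⟨ solve 2 (λ d e → con 1ℚ :+ (d :+ e) :+ d :* e :=
                                                               (con 1ℚ :+ d) :* (con 1ℚ :+ e)) refl δ (m · δ) ⟩
  (1ℚ ℚ.+ δ) ℚ.* (1ℚ ℚ.+ m · δ)           ≤⟨ *-monoˡ-≤ (0≤+ 0≤1 0≤δ) (bernoulli 0≤δ m) ⟩
  (1ℚ ℚ.+ δ) ^ suc m                      ∎
  where open ℚ.≤-Reasoning
        open ℚ.+-*-Solver

-- The square of the linear lower bound for (1 + δ) ^ m outgrows 1 + 2mℓ.
linear-growth⇒≤1 : ∀ ℓ {x} → (∀ m → x ^ m ℚ.≤ suc (m * ℓ) · 1ℚ) → x ℚ.≤ 1ℚ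
linear-growth⇒≤1 ℓ {x} bound with x ℚ.≤? 1ℚ
... | yes x≤1 = x≤1
-- With `δ = x - 1`, the number `m` satisfies `2ℓ + 1 < mδ²`. Then
-- `m(2ℓ + 1) < (mδ)² ≤ x^(2m) ≤ 2mℓ + 1`, which is absurd for positive `m`.
... | no  x≰1 with archimedean (suc (2 * ℓ)) (0<* 0<δ 0<δ)
  where
  0<δ : 0ℚ ℚ.< x ℚ.- 1ℚ
  0<δ = ℚ.+-monoˡ-< (ℚ.- 1ℚ) (ℚ.≰⇒> x≰1)
...   | zero , lt = contradiction
  (ℚ.<-≤-trans lt (·-nonNeg (suc (2 * ℓ)) 0≤1)) (ℚ.<-irrefl refl)
...   | m@(suc m-1) , lt = contradiction too-big (ℚ.<-irrefl refl)
  where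
  open ℚ.≤-Reasoning
  δ = x ℚ.- 1ℚ
  0≤δ : 0ℚ ℚ.≤ δ
  0≤δ = ℚ.<⇒≤ (ℚ.+-monoˡ-< (ℚ.- 1ℚ) (ℚ.≰⇒> x≰1))
  1+δ≡x : 1ℚ ℚ.+ δ ≡ x
  1+δ≡x = solve 1 (λ x → con 1ℚ :+ (x :- con 1ℚ) := x) refl x
    where open ℚ.+-*-Solver
  mδ≤xᵐ : m · δ ℚ.≤ x ^ m
  mδ≤xᵐ = begin
    m · δ             ≡⟨ ℚ.+-identityˡ _ ⟨
    0ℚ ℚ.+ m · δ      ≤⟨ ℚ.+-monoˡ-≤ (m · δ) 0≤1 ⟩
    1ℚ ℚ.+ m · δ      ≤⟨ bernoulli 0≤δ m ⟩
    (1ℚ ℚ.+ δ) ^ m    ≡⟨ cong (_^ m) 1+δ≡x ⟩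
    x ^ m             ∎
  0≤mδ = ·-nonNeg m 0≤δ
  linear≤ : suc ((m + m) * ℓ) ≤ m * suc (2 * ℓ)
  linear≤ = ℕ.≤-trans (ℕ.m≤m+n _ m-1) (ℕ.≤-reflexive
    (solve 2 (λ n ℓ → con 1 :+ (con 1 :+ n :+ (con 1 :+ n)) :* ℓ :+ n :=
                      (con 1 :+ n) :* (con 1 :+ con 2 :* ℓ)) refl m-1 ℓ))
    where open +-*-Solver
  too-big : suc ((m + m) * ℓ) · 1ℚ ℚ.< suc ((m + m) * ℓ) · 1ℚ
  too-big = begin-strict
    suc ((m + m) * ℓ) · 1ℚ   ≤⟨ ·-monoˡ-≤ 0≤1 linear≤ ⟩
    (m * suc (2 * ℓ)) · 1ℚ   ≡⟨ ×-assocˡ 1ℚ m (suc (2 * ℓ)) ⟨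
    m · suc (2 * ℓ) · 1ℚ     <⟨ ·-monoʳ-< m-1 lt ⟩
    m · m · (δ ℚ.* δ)        ≡⟨ cong (m ·_) (×-comm-* m δ δ) ⟨
    m · (δ ℚ.* (m · δ))      ≡⟨ ×-assoc-* m δ (m · δ) ⟨
    m · δ ℚ.* m · δ          ≤⟨ *-mono-≤ 0≤mδ (ℚ.≤-trans 0≤mδ mδ≤xᵐ) mδ≤xᵐ mδ≤xᵐ ⟩
    x ^ m ℚ.* x ^ m          ≡⟨ ^-homo-* x m m ⟨
    x ^ (m + m)              ≤⟨ bound (m + m) ⟩
    suc ((m + m) * ℓ) · 1ℚ   ∎

geometric : ℚ → ℕ → ℚ
geometric x zero    = 0ℚ
geometric x (suc n) = x ^ n ℚ.+ geometric x n

-- A division-free form of the bound `1 / ε` for the geometric series. The induction carries the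
-- remainder `x ^ n`, which pays for the next term because `(x + ε) * x ^ n` is at most `x ^ n`.
geometric-bound : ∀ {x ε} → 0ℚ ℚ.≤ x → x ℚ.+ ε ℚ.≤ 1ℚ → ∀ n → ε ℚ.* geometric x n ℚ.≤ 1ℚ
geometric-bound {x} {ε} 0≤x x+ε≤1 n = begin
  ε ℚ.* geometric x n              ≡⟨ ℚ.+-identityʳ _ ⟨
  ε ℚ.* geometric x n ℚ.+ 0ℚ       ≤⟨ ℚ.+-monoʳ-≤ (ε ℚ.* geometric x n) (^-nonNeg 0≤x n) ⟩
  ε ℚ.* geometric x n ℚ.+ x ^ n    ≤⟨ with-remainder n ⟩
  1ℚ                               ∎
  where
  open ℚ.≤-Reasoning
  open ℚ.+-*-Solver
  with-remainder : ∀ n → ε ℚ.* geometric x n ℚ.+ x ^ n ℚ.≤ 1ℚ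
  with-remainder zero = ℚ.≤-reflexive (trans (cong (ℚ._+ 1ℚ) (ℚ.*-zeroʳ ε)) (ℚ.+-identityˡ 1ℚ))
  with-remainder (suc n) = begin
    ε ℚ.* (x ^ n ℚ.+ geometric x n) ℚ.+ x ℚ.* x ^ n
      ≡⟨ solve 4 (λ e g y x → e :* (y :+ g) :+ x :* y := e :* g :+ (x :+ e) :* y)
           refl ε (geometric x n) (x ^ n) x ⟩
    ε ℚ.* geometric x n ℚ.+ (x ℚ.+ ε) ℚ.* x ^ n
      ≤⟨ ℚ.+-monoʳ-≤ (ε ℚ.* geometric x n)
           (ℚ.*-monoʳ-≤-nonNeg (x ^ n) {{ℚ.nonNegative (^-nonNeg 0≤x n)}} x+ε≤1) ⟩
    ε ℚ.* geometric x n ℚ.+ 1ℚ ℚ.* x ^ n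
      ≡⟨ cong (ε ℚ.* geometric x n ℚ.+_) (ℚ.*-identityˡ _) ⟩
    ε ℚ.* geometric x n ℚ.+ x ^ n
      ≤⟨ with-remainder n ⟩
    1ℚ ∎

-- Injectivity is demanded on the list only, because `concat` is injective just on factorizations
-- over a code.
Unique-map : ∀ {A B : Set} {f : A → B} {xs} → (∀ {x y} → x ∈ xs → y ∈ xs → f x ≡ f y → x ≡ y) →
  Unique xs → Unique (map f xs)
Unique-map inj []        = []
Unique-map inj (x∉ ∷ u) =
  All.map⁺ (All.tabulate λ y∈ fx≡fy → All.lookup x∉ y∈ (inj (here refl) (there y∈) fx≡fy)) ∷
  Unique-map (λ x∈ y∈ → inj (there x∈) (there y∈)) u

1/-homo-* : ∀ m n .{{_ : NonZero m}} .{{_ : NonZero n}} .{{_ : NonZero (m * n)}} →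
  ℤ.+ 1 ℚ./ (m * n) ≡ (ℤ.+ 1 ℚ./ m) ℚ.* (ℤ.+ 1 ℚ./ n)
1/-homo-* (suc m) (suc n) = sym (cong₂ ℚ._*_ (1/≡1/suc m) (1/≡1/suc n))

n·1/n : ∀ n .{{_ : NonZero n}} → n · (ℤ.+ 1 ℚ./ n) ≡ 1ℚ
n·1/n (suc n) = trans (cong (suc n ·_) (1/≡1/suc n)) (suc·1/suc n)

module _ (𝒜 : Alphabet) where
  open Alphabet 𝒜
  open Words 𝒜

  -- Extension of an independent code by one word

  insert : Language → Word → Language
  insert X y = X ∪ ｛ y ｝

  module _ {X : Language} {y : Word} where

    private
      -- A factorization over `insert X y` cut at its entries `y`; the stretches in between are
      -- factorizations over `X`, to which the code property of `X` applies.
      data Blocks : List Word → Set where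
        last : ∀ {us} → All X us → Blocks us
        cons : ∀ {us xs} → All X us → Blocks xs → Blocks (us ++ y ∷ xs)

      blocks : ∀ {xs} → All (insert X y) xs → Blocks xs
      blocks []                = last []
      blocks (inj₂ refl ∷ xs∈) = cons [] (blocks xs∈)
      blocks (inj₁ x∈ ∷ xs∈) with blocks xs∈
      ... | last us∈     = last (x∈ ∷ us∈)
      ... | cons us∈ bs  = cons (x∈ ∷ us∈) bs

      concat-block : ∀ (us : List Word) xs → concat (us ++ y ∷ xs) ≡ concat us ++ y ++ concat xs
      concat-block us xs = sym (concat-++ us (y ∷ xs))

    -- No product over `X` contains `y`, so two equal products are cut by `++-cut` at the same first
    -- `y`. The stretches before it agree since `X` is a code, and the rest follows by induction.
    insert-code : Code X → Unbordered y → (∀ {z} → (X ⋆) z → ¬ Factor y z) → Code (insert X y)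
    insert-code code unb y∤X⋆ xs∈ ys∈ = go (blocks xs∈) (blocks ys∈)
      where
      go : ∀ {xs ys} → Blocks xs → Blocks ys → concat xs ≡ concat ys → xs ≡ ys
      go (last us∈) (last vs∈) eq = code us∈ vs∈ eq
      go (last us∈) (cons {vs} {ys} vs∈ _) eq =
        contradiction (concat vs , concat ys , trans eq (concat-block vs ys)) (y∤X⋆ (_ , us∈ , refl))
      go (cons {us} {xs} us∈ _) (last vs∈) eq =
        contradiction (concat us , concat xs , trans (sym eq) (concat-block us xs)) (y∤X⋆ (_ , vs∈ , refl))
      go (cons {us} {xs} us∈ bs) (cons {vs} {ys} vs∈ cs) eq
        with us≡vs , xs≡ys ← ++-cut unb (concat us) (concat vs)
               (y∤X⋆ (_ , us∈ , refl)) (y∤X⋆ (_ , vs∈ , refl))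
               (trans (sym (concat-block us xs)) (trans eq (concat-block vs ys)))
        = cong₂ (λ us xs → us ++ y ∷ xs) (code us∈ vs∈ us≡vs) (go bs cs xs≡ys)

  ∧-prefix : ∀ u v → ∃₂ λ u′ v′ → u ≡ (u ∧ v) ++ u′ × v ≡ (u ∧ v) ++ v′
  ∧-prefix []      v  = [] , v , refl , refl
  ∧-prefix (a ∷ u) [] = a ∷ u , [] , refl , refl
  ∧-prefix (a ∷ u) (b ∷ v) with a ≟ b
  ... | no _ = a ∷ u , b ∷ v , refl , refl
  ... | yes refl with u′ , v′ , u≡ , v≡ ← ∧-prefix u v =
    u′ , v′ , cong (a ∷_) u≡ , cong (a ∷_) v≡

  -- Once the longest common prefix is removed, the lengths of the two remainders add up to the
  -- distance.
  𝒫⇒common-prefix : ∀ {k} u v → 𝒫 k u v →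
    ∃ λ p → ∃₂ λ u′ v′ → u ≡ p ++ u′ × v ≡ p ++ v′ × length u′ ≤ k × length v′ ≤ k
  𝒫⇒common-prefix {k} u v close with u′ , v′ , u≡ , v≡ ← ∧-prefix u v =
    u ∧ v , u′ , v′ , u≡ , v≡ ,
    ℕ.≤-trans (ℕ.m≤m+n _ _) sum≤k , ℕ.≤-trans (ℕ.m≤n+m _ _) sum≤k
    where
    ℓ = length (u ∧ v)
    distance : length u + length v ∸ 2 * ℓ ≡ length u′ + length v′
    distance = begin
      length u + length v ∸ 2 * ℓ
        ≡⟨ cong (_∸ 2 * ℓ) (cong₂ _+_ (trans (cong length u≡) (length-++ (u ∧ v)))
                                        (trans (cong length v≡) (length-++ (u ∧ v)))) ⟩
      ℓ + length u′ + (ℓ + length v′) ∸ 2 * ℓ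
        ≡⟨ cong (_∸ 2 * ℓ) (solve 3 (λ l x y → l :+ x :+ (l :+ y) := con 2 :* l :+ (x :+ y))
                                      refl ℓ (length u′) (length v′)) ⟩
      2 * ℓ + (length u′ + length v′) ∸ 2 * ℓ
        ≡⟨ ℕ.m+n∸m≡n (2 * ℓ) _ ⟩
      length u′ + length v′ ∎
      where open ≡-Reasoning
            open +-*-Solver
    sum≤k : length u′ + length v′ ≤ k
    sum≤k = subst (_≤ k) distance close

  -- The suffix `v′` is too short to reach back into `c`, so `c` is a prefix of `p`.
  common-prefix-factor : ∀ (p : Word) u′ v′ c s → length v′ < length s → p ++ v′ ≡ c ++ s →
    Factor c (p ++ u′)
  common-prefix-factor p u′ v′ c s v′<s eq with equidivisible c p (sym eq)
  ... | inj₁ (t , refl , _)    = [] , t ++ u′ , ++-assoc c t u′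
  ... | inj₂ (t , refl , refl) = contradiction
    (Factor-length (t , [] , cong (t ++_) (sym (++-identityʳ s)))) (ℕ.<⇒≱ v′<s)

  insert-independent : ∀ {k X} → Independent (𝒫̲ k) X → ∀ (c s : Word) → k < length s →
    (∀ {x} → X x → ¬ Factor c x) → Independent (𝒫̲ k) (insert X (c ++ s))
  insert-independent ind c s k<s c∤X v ((x , inj₁ x∈ , τ) , inj₁ v∈) = ind v ((x , x∈ , τ) , v∈)
  insert-independent ind c s k<s c∤X _ ((_ , inj₂ refl , _ , y≢y) , inj₂ refl) = y≢y refl
  insert-independent ind c s k<s c∤X v ((x , inj₁ x∈ , close , _) , inj₂ refl)
    with p , u′ , v′ , refl , y≡ , _ , v′≤k ← 𝒫⇒common-prefix x v close =
    c∤X x∈ (common-prefix-factor p u′ v′ c s (ℕ.≤-<-trans v′≤k k<s) (sym y≡))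
  insert-independent ind c s k<s c∤X v ((x , inj₂ refl , close , _) , inj₁ v∈)
    with p , u′ , v′ , y≡ , refl , u′≤k , _ ← 𝒫⇒common-prefix x v close =
    c∤X v∈ (common-prefix-factor p v′ u′ c s (ℕ.≤-<-trans u′≤k k<s) (sym y≡))

  -- The star of a recognized language

  module _ (M : Automaton Letter) where
    open Automaton M
    private
      M⁺ = plus M
      module M⁺ = Automaton M⁺

      embed : ∀ {p w q} → Path p w q → M⁺.Path p w q
      embed []       = M⁺.[]
      embed (e ∷ π) = ∈-comprehension⁺ (step⁺? M _ _) (step e) M⁺.∷ embed π

      -- The jump is merged into the first edge of the path; if that edge is itself a jump, the two
      -- become one. An empty path has no edge to carry the jump, whence the alternative.
      restart : ∀ {t i w r} → t Subset.∈ terminal → i Subset.∈ initial →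
        M⁺.Path i w r → w ≡ [] ⊎ M⁺.Path t w r
      restart t∈ i∈ M⁺.[]       = inj₁ refl
      restart t∈ i∈ (e M⁺.∷ π) with ∈-comprehension⁻ (step⁺? M _ _) e
      ... | step e′       = inj₂ (∈-comprehension⁺ (step⁺? M _ _) (jump t∈ i∈ e′) M⁺.∷ π)
      ... | jump _ i′∈ e′ = inj₂ (∈-comprehension⁺ (step⁺? M _ _) (jump t∈ i′∈ e′) M⁺.∷ π)

      -- Here `u` is what is read before the first jump. The start state `p` is arbitrary so that
      -- the induction on the path goes through.
      unwind : ∀ {p w t} → M⁺.Path p w t → t Subset.∈ terminal →
        ∃₂ λ u v → w ≡ u ++ v × (∃ λ t′ → t′ Subset.∈ terminal × Path p u t′) × (Recognized ⋆) v
      unwind M⁺.[] t∈ = [] , [] , refl , (_ , t∈ , []) , ([] , [] , refl)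
      unwind {w = a ∷ _} (e M⁺.∷ π) t∈ with ∈-comprehension⁻ (step⁺? M _ _) e | unwind π t∈
      ... | step e′ | u , v , refl , (t′ , t′∈ , σ) , v∈ =
        a ∷ u , v , refl , (t′ , t′∈ , e′ ∷ σ) , v∈
      ... | jump p∈ i∈ e′ | u , v , refl , (t′ , t′∈ , σ) , (xs , xs∈ , refl) =
        [] , a ∷ u ++ v , refl , (_ , p∈ , []) ,
        ((a ∷ u) ∷ xs , (_ , _ , i∈ , t′∈ , e′ ∷ σ) ∷ xs∈ , refl)

    plus⇒⋆ : ∀ {w} → M⁺.Recognized w → (Recognized ⋆) w
    plus⇒⋆ (_ , _ , i∈ , t∈ , π)
      with u , _ , refl , (_ , t′∈ , σ) , (xs , xs∈ , refl) ← unwind π t∈ =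
      u ∷ xs , (_ , _ , i∈ , t′∈ , σ) ∷ xs∈ , refl

    ⋆⇒plus : ∀ {w} → (Recognized ⋆) w → w ≡ [] ⊎ M⁺.Recognized w
    ⋆⇒plus ([]     , []                           , refl) = inj₁ refl
    ⋆⇒plus (x ∷ xs , (i , t , i∈ , t∈ , π) ∷ xs∈ , refl) with ⋆⇒plus (xs , xs∈ , refl)
    ... | inj₁ eq rewrite eq | ++-identityʳ x = inj₂ (i , t , i∈ , t∈ , embed π)
    ... | inj₂ (_ , t′ , i′∈ , t′∈ , σ) with restart t∈ i′∈ σ
    ...   | inj₁ eq rewrite eq | ++-identityʳ x = inj₂ (i , t , i∈ , t∈ , embed π)
    ...   | inj₂ σ′ = inj₂ (i , t′ , i∈ , t′∈ , path-++ M⁺ (embed π) σ′)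

    recognized⋆? : Decidable (Recognized ⋆)
    recognized⋆? []      = yes ([] , [] , refl)
    recognized⋆? (a ∷ w) = map′ plus⇒⋆ (λ w∈ → nonempty (⋆⇒plus w∈)) (recognized? M⁺ (a ∷ w))
      where
      nonempty : (a ∷ w) ≡ [] ⊎ M⁺.Recognized (a ∷ w) → M⁺.Recognized (a ∷ w)
      nonempty (inj₂ w∈) = w∈

    -- The accepting path is cut at both ends of `v`. The outer pieces lose their loops; the piece
    -- that reads `v` is kept.
    short-context : ∀ u v w → (Recognized ⋆) (u ++ v ++ w) →
      ∃₂ λ u′ w′ → length u′ ≤ size × length w′ ≤ size × (Recognized ⋆) (u′ ++ v ++ w′)
    short-context u v w z∈ with ⋆⇒plus z∈
    ... | inj₁ eq rewrite ++-conicalˡ v w (++-conicalʳ u (v ++ w) eq) =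
      [] , [] , z≤n , z≤n , ([] , [] , refl)
    ... | inj₂ (i , t , i∈ , t∈ , π)
      with p , ρ , π′ ← path-split M⁺ u π
      with q , σ , τ ← path-split M⁺ v π′
      with u′ , u′≤ , ρ′ ← shorten M⁺ ρ | w′ , w′≤ , τ′ ← shorten M⁺ τ =
      u′ , w′ , u′≤ , w′≤ , plus⇒⋆ (i , t , i∈ , t∈ , path-++ M⁺ ρ′ (path-++ M⁺ σ τ′))

  -- Masses of finite sets of words and the Kraft–McMillan inequality

  letter-weight : ℚ
  letter-weight = ℤ.+ 1 ℚ./ card

  weight-∷ : ∀ a w → weight (a ∷ w) ≡ letter-weight ℚ.* weight w
  weight-∷ a w = 1/-homo-* card (card ℕ.^ length w)
    {{card-nonZero}} {{m^n≢0 card (length w)}} {{m^n≢0 card (suc (length w))}}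

  weight-++ : ∀ u v → weight (u ++ v) ≡ weight u ℚ.* weight v
  weight-++ []      v = sym (ℚ.*-identityˡ (weight v))
  weight-++ (a ∷ u) v = begin
    weight (a ∷ u ++ v)                          ≡⟨ weight-∷ a (u ++ v) ⟩
    letter-weight ℚ.* weight (u ++ v)            ≡⟨ cong (letter-weight ℚ.*_) (weight-++ u v) ⟩
    letter-weight ℚ.* (weight u ℚ.* weight v)    ≡⟨ ℚ.*-assoc letter-weight (weight u) (weight v) ⟨
    letter-weight ℚ.* weight u ℚ.* weight v      ≡⟨ cong (ℚ._* weight v) (weight-∷ a u) ⟨
    weight (a ∷ u) ℚ.* weight v                  ∎
    where open ≡-Reasoning

  0<weight : ∀ w → 0ℚ ℚ.< weight w
  0<weight w = ℚ.positive⁻¹ _ {{ℚ.normalize-pos 1 (card ℕ.^ length w) {{m^n≢0 card (length w)}}}}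

  weight-inverse : ∀ w → (card ℕ.^ length w) · weight w ≡ 1ℚ
  weight-inverse w = n·1/n (card ℕ.^ length w) {{m^n≢0 card (length w)}}

  0≤mass : ∀ ws → 0ℚ ℚ.≤ mass ws
  0≤mass []       = ℚ.≤-refl
  0≤mass (w ∷ ws) = 0≤+ (ℚ.<⇒≤ (0<weight w)) (0≤mass ws)

  mass-++ : ∀ us vs → mass (us ++ vs) ≡ mass us ℚ.+ mass vs
  mass-++ []       vs = sym (ℚ.+-identityˡ (mass vs))
  mass-++ (u ∷ us) vs = trans (cong (weight u ℚ.+_) (mass-++ us vs))
    (sym (ℚ.+-assoc (weight u) (mass us) (mass vs)))

  -- One occurrence of `u` is taken out of `vs`; as `u` does not recur in `us`, the other words
  -- still lie in what remains. The list `vs` may thus be a cover with repetitions.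
  mass-mono : ∀ {us vs} → Unique us → us ⊆ˡ vs → mass us ℚ.≤ mass vs
  mass-mono {vs = vs} [] _ = 0≤mass vs
  mass-mono {u ∷ us} (u∉ ∷ us!) us⊆vs with ys , zs , refl ← ∈-∃++ (us⊆vs (here refl)) = begin
    weight u ℚ.+ mass us                         ≤⟨ ℚ.+-monoʳ-≤ (weight u) (mass-mono us! us⊆) ⟩
    weight u ℚ.+ mass (ys ++ zs)                 ≡⟨ cong (weight u ℚ.+_) (mass-++ ys zs) ⟩
    weight u ℚ.+ (mass ys ℚ.+ mass zs)           ≡⟨ ℚ.+-assoc (weight u) (mass ys) (mass zs) ⟨
    weight u ℚ.+ mass ys ℚ.+ mass zs             ≡⟨ cong (ℚ._+ mass zs) (ℚ.+-comm (weight u) (mass ys)) ⟩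
    mass ys ℚ.+ weight u ℚ.+ mass zs             ≡⟨ ℚ.+-assoc (mass ys) (weight u) (mass zs) ⟩
    mass ys ℚ.+ (weight u ℚ.+ mass zs)           ≡⟨ mass-++ ys (u ∷ zs) ⟨
    mass (ys ++ u ∷ zs)                          ∎
    where
    open ℚ.≤-Reasoning
    us⊆ : us ⊆ˡ ys ++ zs
    us⊆ w∈ with ∈-++⁻ ys (us⊆vs (there w∈))
    ... | inj₁ w∈ys         = ∈-++⁺ˡ w∈ys
    ... | inj₂ (here refl)  = contradiction refl (All.lookup u∉ w∈)
    ... | inj₂ (there w∈zs) = ∈-++⁺ʳ ys w∈zs

  mass-scaled : ∀ x (f : Word → Word) ws → (∀ w → weight (f w) ≡ x ℚ.* weight w) →
    mass (map f ws) ≡ x ℚ.* mass ws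
  mass-scaled x f []       eq = sym (ℚ.*-zeroʳ x)
  mass-scaled x f (w ∷ ws) eq = trans (cong₂ ℚ._+_ (eq w) (mass-scaled x f ws eq))
    (sym (ℚ.*-distribˡ-+ x (weight w) (mass ws)))

  -- Powers of a finite set of words

  tuples : List Word → ℕ → List (List Word)
  tuples ws zero    = [ [] ]
  tuples ws (suc n) = cartesianProductWith _∷_ ws (tuples ws n)

  ∈-tuples⁺ : ∀ {ws xs} → All (_∈ ws) xs → xs ∈ tuples ws (length xs)
  ∈-tuples⁺ []           = here refl
  ∈-tuples⁺ (x∈ ∷ xs∈) = ∈-cartesianProductWith⁺ _∷_ x∈ (∈-tuples⁺ xs∈)

  ∈-tuples⁻ : ∀ ws n {xs} → xs ∈ tuples ws n → All (_∈ ws) xs × length xs ≡ n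
  ∈-tuples⁻ ws zero    (here refl) = [] , refl
  ∈-tuples⁻ ws (suc n) xs∈ with x , ys , x∈ , ys∈ , refl ← ∈-cartesianProductWith⁻ _∷_ ws (tuples ws n) xs∈
    with all , refl ← ∈-tuples⁻ ws n ys∈ = x∈ ∷ all , refl

  tuples-unique : ∀ {ws} n → Unique ws → Unique (tuples ws n)
  tuples-unique zero    ws! = [] ∷ []
  tuples-unique (suc n) ws! = Unique.cartesianProductWith⁺ _∷_ ∷-injective ws! (tuples-unique n ws!)

  power : List Word → ℕ → List Word
  power ws n = map concat (tuples ws n)

  -- Expansion of the product `mass ws ^ n`, since `weight` is multiplicative; concatenations are
  -- counted with multiplicity.
  mass-power : ∀ ws n → mass (power ws n) ≡ mass ws ^ n
  mass-power ws zero    = ℚ.+-identityʳ 1ℚ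
  mass-power ws (suc n) = trans (mass-product ws) (cong (mass ws ℚ.*_) (mass-power ws n))
    where
    open ≡-Reasoning
    mass-prepend : ∀ w xss → mass (map concat (map (w ∷_) xss)) ≡ weight w ℚ.* mass (map concat xss)
    mass-prepend w []         = sym (ℚ.*-zeroʳ (weight w))
    mass-prepend w (xs ∷ xss) = trans (cong₂ ℚ._+_ (weight-++ w (concat xs)) (mass-prepend w xss))
      (sym (ℚ.*-distribˡ-+ (weight w) (weight (concat xs)) (mass (map concat xss))))
    mass-product : ∀ vs → mass (map concat (cartesianProductWith _∷_ vs (tuples ws n))) ≡
      mass vs ℚ.* mass (power ws n)
    mass-product []       = sym (ℚ.*-zeroˡ (mass (power ws n)))
    mass-product (v ∷ vs) = begin
      mass (map concat (map (v ∷_) T ++ cartesianProductWith _∷_ vs T))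
        ≡⟨ cong mass (map-++ concat (map (v ∷_) T) _) ⟩
      mass (map concat (map (v ∷_) T) ++ map concat (cartesianProductWith _∷_ vs T))
        ≡⟨ mass-++ (map concat (map (v ∷_) T)) _ ⟩
      mass (map concat (map (v ∷_) T)) ℚ.+ mass (map concat (cartesianProductWith _∷_ vs T))
        ≡⟨ cong₂ ℚ._+_ (mass-prepend v T) (mass-product vs) ⟩
      weight v ℚ.* mass (power ws n) ℚ.+ mass vs ℚ.* mass (power ws n)
        ≡⟨ ℚ.*-distribʳ-+ (mass (power ws n)) (weight v) (mass vs) ⟨
      mass (v ∷ vs) ℚ.* mass (power ws n) ∎
      where T = tuples ws n

  -- The point where unique factorization enters the Kraft-McMillan bound: different tuples have
  -- different concatenations.
  power-unique : ∀ {ws} n → Code (_∈ ws) → Unique ws → Unique (power ws n)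
  power-unique {ws} n code ws! = Unique-map
    (λ xs∈ ys∈ → code (proj₁ (∈-tuples⁻ ws n xs∈)) (proj₁ (∈-tuples⁻ ws n ys∈)))
    (tuples-unique n ws!)

  powers< : List Word → ℕ → List Word
  powers< ws zero    = []
  powers< ws (suc n) = power ws n ++ powers< ws n

  ∈-powers<⁺ : ∀ {ws n w} m → m < n → w ∈ power ws m → w ∈ powers< ws n
  ∈-powers<⁺ {ws} {suc n} m m<n w∈ with m ℕ.≟ n
  ... | yes refl = ∈-++⁺ˡ w∈
  ... | no  m≢n  = ∈-++⁺ʳ (power ws n) (∈-powers<⁺ m (ℕ.≤∧≢⇒< (ℕ.≤-pred m<n) m≢n) w∈)

  mass-powers< : ∀ ws n → mass (powers< ws n) ≡ geometric (mass ws) n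
  mass-powers< ws zero    = refl
  mass-powers< ws (suc n) = trans (mass-++ (power ws n) (powers< ws n))
    (cong₂ ℚ._+_ (mass-power ws n) (mass-powers< ws n))

  -- Words of bounded length as powers of the alphabet

  from-injective : ∀ {i j} → Inverse.from enum i ≡ Inverse.from enum j → i ≡ j
  from-injective eq = trans (sym (Inverse.strictlyInverseˡ enum _))
    (trans (cong (Inverse.to enum) eq) (Inverse.strictlyInverseˡ enum _))

  -- The letters are taken as words of length 1. They form a code, so the results on powers apply to
  -- the set of all words of a given length.
  letters : List Word
  letters = map (λ i → [ Inverse.from enum i ]) (allFin card)

  ∈-letters : ∀ a → [ a ] ∈ letters
  ∈-letters a = subst (λ b → [ b ] ∈ letters) (Inverse.strictlyInverseʳ enum a)
    (∈-map⁺ (λ i → [ Inverse.from enum i ]) (∈-allFin (Inverse.to enum a)))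

  ∈-letters⁻ : ∀ {w} → w ∈ letters → ∃ λ a → w ≡ [ a ]
  ∈-letters⁻ w∈ with i , _ , refl ← ∈-map⁻ _ w∈ = Inverse.from enum i , refl

  letters-unique : Unique letters
  letters-unique = Unique.map⁺ (from-injective ∘ proj₁ ∘ ∷-injective) (Unique.allFin⁺ card)

  letters-code : Code (_∈ letters)
  letters-code [] [] _ = refl
  letters-code [] (y∈ ∷ _) eq with ∈-letters⁻ y∈
  letters-code [] (y∈ ∷ _) () | _ , refl
  letters-code (x∈ ∷ _) [] eq with ∈-letters⁻ x∈
  letters-code (x∈ ∷ _) [] () | _ , refl
  letters-code (x∈ ∷ xs∈) (y∈ ∷ ys∈) eq
    with _ , refl ← ∈-letters⁻ x∈ | _ , refl ← ∈-letters⁻ y∈ with refl , eq′ ← ∷-injective eq =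
    cong (_ ∷_) (letters-code xs∈ ys∈ eq′)

  mass-letters : mass letters ≡ 1ℚ
  mass-letters = begin
    mass letters                         ≡⟨ go (allFin card) ⟩
    length (allFin card) · letter-weight ≡⟨ cong (_· letter-weight) (length-tabulate {n = card} id) ⟩
    card · letter-weight                 ≡⟨ n·1/n card ⟩
    1ℚ                                   ∎
    where
    open ≡-Reasoning
    go : ∀ is → mass (map (λ i → [ Inverse.from enum i ]) is) ≡ length is · letter-weight
    go []       = refl
    go (i ∷ is) = cong₂ ℚ._+_
      (trans (weight-∷ (Inverse.from enum i) []) (ℚ.*-identityʳ letter-weight)) (go is)

  words< : ℕ → List Word
  words< = powers< letters

  length-words : ∀ n {w} → w ∈ power letters n → length w ≡ n
  length-words n w∈ with xs , xs∈ , refl ← ∈-map⁻ concat w∈ with all , refl ← ∈-tuples⁻ letters n xs∈ = go all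
    where
    go : ∀ {xs} → All (_∈ letters) xs → length (concat xs) ≡ length xs
    go []          = refl
    go (x∈ ∷ xs∈) with _ , refl ← ∈-letters⁻ x∈ = cong suc (go xs∈)

  ∈-words<⁺ : ∀ {n} w → length w < n → w ∈ words< n
  ∈-words<⁺ w w<n = ∈-powers<⁺ (length w) w<n
    (subst₂ (λ v m → v ∈ power letters m) (concat-map-[ w ]) (length-map [_] w)
      (∈-map⁺ concat (∈-tuples⁺ (All.map⁺ (All.universal ∈-letters w)))))

  ∈-words<⁻ : ∀ n {w} → w ∈ words< n → length w < n
  ∈-words<⁻ (suc n) w∈ with ∈-++⁻ (power letters n) w∈
  ... | inj₁ w∈ = s≤s (ℕ.≤-reflexive (length-words n w∈))
  ... | inj₂ w∈ = ℕ.m<n⇒m<1+n (∈-words<⁻ n w∈)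

  words<-unique : ∀ n → Unique (words< n)
  words<-unique zero    = []
  words<-unique (suc n) = Unique.++⁺ (power-unique n letters-code letters-unique) (words<-unique n)
    λ (w∈ , w∈′) → ℕ.<-irrefl (length-words n w∈) (∈-words<⁻ n w∈′)

  -- The alphabet has mass 1, so each of the lengths below `n` contributes 1.
  mass-words< : ∀ n → mass (words< n) ≡ n · 1ℚ
  mass-words< n = trans (mass-powers< letters n)
    (trans (cong (λ x → geometric x n) mass-letters) (geometric-1 n))
    where
    1^n : ∀ n → 1ℚ ^ n ≡ 1ℚ
    1^n zero    = refl
    1^n (suc n) = trans (ℚ.*-identityˡ _) (1^n n)
    geometric-1 : ∀ n → geometric 1ℚ n ≡ n · 1ℚ
    geometric-1 zero    = refl
    geometric-1 (suc n) = cong₂ ℚ._+_ (1^n n) (geometric-1 n)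

  length-concat-≤ : ∀ {ℓ} {xs : List Word} → All (λ w → length w ≤ ℓ) xs → length (concat xs) ≤ length xs * ℓ
  length-concat-≤ []                    = z≤n
  length-concat-≤ {xs = x ∷ _} (x≤ ∷ xs≤) =
    subst (_≤ _) (sym (length-++ x)) (ℕ.+-mono-≤ x≤ (length-concat-≤ xs≤))

  bounded : ∀ (ws : List Word) → ∃ λ ℓ → All (λ w → length w ≤ ℓ) ws
  bounded []       = 0 , []
  bounded (w ∷ ws) with ℓ , ws≤ ← bounded ws = length w + ℓ ,
    ℕ.m≤m+n _ _ ∷ All.map (λ v≤ → ℕ.≤-trans v≤ (ℕ.m≤n+m _ _)) ws≤

  -- The `m`-th power of `ws` consists of distinct words of length at most `m * ℓ`, so its mass is
  -- bounded linearly in `m`. A power `mass ws ^ m` with base above 1 would outgrow this.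
  kraft-mcmillan : ∀ {X} → Code X → ∀ {ws} → Unique ws → All X ws → mass ws ℚ.≤ 1ℚ
  kraft-mcmillan code {ws} ws! ws∈ with ℓ , ws≤ ← bounded ws = linear-growth⇒≤1 ℓ λ m → begin
    mass ws ^ m                      ≡⟨ mass-power ws m ⟨
    mass (power ws m)                ≤⟨ mass-mono (power-unique m ws-code ws!) (power⊆words< m) ⟩
    mass (words< (suc (m * ℓ)))      ≡⟨ mass-words< (suc (m * ℓ)) ⟩
    suc (m * ℓ) · 1ℚ                 ∎
    where
    open ℚ.≤-Reasoning
    ws-code : Code (_∈ ws)
    ws-code xs∈ ys∈ = code (All.map (All.lookup ws∈) xs∈) (All.map (All.lookup ws∈) ys∈)
    power⊆words< : ∀ m → power ws m ⊆ˡ words< (suc (m * ℓ))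
    power⊆words< m w∈ with xs , xs∈ , refl ← ∈-map⁻ concat w∈ with all , refl ← ∈-tuples⁻ ws m xs∈ =
      ∈-words<⁺ (concat xs) (s≤s (length-concat-≤ (All.map (All.lookup ws≤) all)))

  -- Maximality, completeness and measure

  ⋆-mono : ∀ {X Y : Language} → X ⊆ Y → X ⋆ ⊆ Y ⋆
  ⋆-mono X⊆Y (xs , xs∈ , eq) = xs , All.map X⊆Y xs∈ , eq

  ⊆⋆ : ∀ {X : Language} → X ⊆ X ⋆
  ⊆⋆ {x = x} x∈ = [ x ] , x∈ ∷ [] , ++-identityʳ x

  distinct-letters : ∃₂ λ (a b : Letter) → a ≢ b
  distinct-letters = Inverse.from enum 0F , Inverse.from enum 1F , λ eq →
    ℕ.0≢1+n (trans (sym (Fin.toℕ-fromℕ< (ℕ.<-trans (ℕ.n<1+n 0) 2≤card)))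
      (trans (cong Fin.toℕ (from-injective eq)) (Fin.toℕ-fromℕ< 2≤card)))
    where
    0F 1F : Fin card
    0F = fromℕ< (ℕ.<-trans (ℕ.n<1+n 0) 2≤card)
    1F = fromℕ< 2≤card

  incomplete⇒extension : ∀ {k X} → IndependentCode (𝒫̲ k) X → ∀ w →
    ¬ (∃ λ z → (X ⋆) z × Factor w z) →
    ∃ λ y → ¬ X y × IndependentCode (𝒫̲ k) (insert X y)
  incomplete⇒extension {k} {X} (code , ind) w w∤X⋆ with a , b , a≢b ← distinct-letters =
    y , (λ y∈ → y∤X⋆ (⊆⋆ {X} y∈) ([] , [] , sym (++-identityʳ y))) ,
    insert-code code (padded-unbordered a≢b w (s≤s (ℕ.m≤m+n _ k))) y∤X⋆ ,
    insert-independent ind c (replicate n b)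
      (subst (k <_) (sym (length-replicate n)) (s≤s (ℕ.m≤n+m k (length c))))
      (λ x∈ c∣x → w∤X⋆ (_ , ⊆⋆ {X} x∈ , Factor-trans w∣c c∣x))
    where
    c = (a ∷ w) ∷ʳ a
    -- Larger than `length c`, as unborderedness requires, and larger than `k`, as independence
    -- requires.
    n = suc (length c + k)
    y = padded a≢b w n
    w∣c : Factor w c
    w∣c = [ a ] , [ a ] , refl
    y∤X⋆ : ∀ {z} → (X ⋆) z → ¬ Factor y z
    y∤X⋆ z∈ y∣z = w∤X⋆ (_ , z∈ , Factor-trans w∣c (Factor-trans ([] , replicate n b , refl) y∣z))

  []∉code : ∀ {X} → Code X → ¬ X []
  []∉code code []∈ with () ← code ([]∈ ∷ []) [] refl

  measure-1⇒maximal : ∀ {X} → Decidable X → Code X → HasMeasure X 1ℚ → MaximalCode X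
  measure-1⇒maximal {X} X? code μ = code , λ Y Y-code X⊆Y → (λ {y} → Y⊆X Y Y-code X⊆Y {y}) , X⊆Y
    where
    Y⊆X : ∀ Y → Code Y → X ⊆ Y → Y ⊆ X
    Y⊆X Y Y-code X⊆Y {y} y∈ with X? y
    ... | yes y∈X = y∈X
    -- With `weight y` as the tolerance, a finite part of `X` together with `y` has mass above 1,
    -- although it lies in the code `Y`.
    ... | no  y∉X with ws , ws! , ws∈ , close ← HasMeasure.approach μ (weight y) (0<weight y) =
      contradiction (ℚ.<-≤-trans 1<mass (kraft-mcmillan Y-code
        (All.map (λ w∈ y≡w → y∉X (subst X (sym y≡w) w∈)) ws∈ ∷ ws!) (y∈ ∷ All.map X⊆Y ws∈)))
        (ℚ.<-irrefl refl)
      where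
      open ℚ.≤-Reasoning
      1<mass : 1ℚ ℚ.< weight y ℚ.+ mass ws
      1<mass = begin-strict
        1ℚ                                ≡⟨ solve 1 (λ x → con 1ℚ := x :+ (con 1ℚ :- x)) refl (weight y) ⟩
        weight y ℚ.+ (1ℚ ℚ.- weight y)    <⟨ ℚ.+-monoʳ-< (weight y) close ⟩
        weight y ℚ.+ mass ws              ∎
        where open ℚ.+-*-Solver

  -- Every factor has length at least 1. Hence a word of `X ⋆` of length below `n` is a product of
  -- fewer than `n` words of `X`, each of length below `n`.
  length-concat : ∀ {X : Language} → ¬ X [] → ∀ {xs : List Word} → All X xs →
    length xs ≤ length (concat xs) × All (λ (x : Word) → length x ≤ length (concat xs)) xs
  length-concat []∉ [] = z≤n , []
  length-concat []∉ {[] ∷ _} (x∈ ∷ _) = contradiction x∈ []∉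
  length-concat []∉ {x@(_ ∷ x′) ∷ xs} (x∈ ∷ xs∈) with count , parts ← length-concat []∉ xs∈
    rewrite length-++ x′ {concat xs} =
    s≤s (ℕ.≤-trans count (ℕ.m≤n+m _ _)) ,
    s≤s (ℕ.m≤m+n _ _) ∷ All.map (λ p → ℕ.≤-trans p (ℕ.m≤n⇒m≤1+n (ℕ.m≤n+m _ _))) parts

  -- Regular languages: decidability and contexts

  module _ {X : Language} (X-regular : Regular X) where
    private
      M = proj₁ X-regular
      X⊆M = proj₁ (proj₂ X-regular)
      M⊆X = proj₂ (proj₂ X-regular)
    open Automaton M using (size; Recognized)

    regular? : Decidable X
    regular? w = map′ M⊆X X⊆M (recognized? M w)

    regular⋆? : Decidable (X ⋆)
    regular⋆? w = map′ (⋆-mono {Recognized} {X} M⊆X) (⋆-mono {X} {Recognized} X⊆M) (recognized⋆? M w)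

    private
      contexts : List Word
      contexts = words< (suc size)

    context : ∀ {v z} → (X ⋆) z → Factor v z →
      ∃ λ u → u ∈ contexts × ∃ λ w → w ∈ contexts × (X ⋆) (u ++ v ++ w)
    context {v} z∈ (u , w , refl)
      with u′ , w′ , u′≤ , w′≤ , z′∈ ← short-context M u v w (⋆-mono {X} {Recognized} X⊆M z∈) =
      u′ , ∈-words<⁺ u′ (s≤s u′≤) , w′ , ∈-words<⁺ w′ (s≤s w′≤) , ⋆-mono {Recognized} {X} M⊆X z′∈

    -- By `context`, a search over pairs of words of length at most `size` is exhaustive.
    factor? : Decidable (λ v → ∃ λ z → (X ⋆) z × Factor v z)
    factor? v = map′
      (λ any → let u , _ , any′ = find any ; w , _ , z∈ = find any′ in u ++ v ++ w , z∈ , u , w , refl)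
      (λ (_ , z∈ , v∣z) → let _ , u∈ , _ , w∈ , z′∈ = context z∈ v∣z in lose u∈ (lose w∈ z′∈))
      (Any.any? (λ u → Any.any? (λ w → regular⋆? (u ++ v ++ w)) contexts) contexts)

    -- The extension by `y` is an independent code, hence a member of any family `F` above these;
    -- `F` is instantiated both with the independent codes and with all codes.
    maximal⇒complete : ∀ {k F} → IndependentCode (𝒫̲ k) ⊆ F → IndependentCode (𝒫̲ k) X →
      MaximalIn F X → Complete X
    maximal⇒complete ind⊆F ind (_ , maximal) w with factor? w
    ... | yes (z , z∈ , w∣z) = z , z∈ , Factor⇒Infix w∣z
    ... | no  w∤X⋆ with y , y∉X , ind′ ← incomplete⇒extension ind w w∤X⋆ =
      contradiction (proj₁ (maximal (insert X y) (ind⊆F ind′) inj₁) (inj₂ refl)) y∉X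

    -- Linear growth of the mass of `X ⋆`

    private
      star-words : ℕ → List Word
      star-words n = filter regular⋆? (words< n)

      -- A word reappears for every context in the list that completes it into `X ⋆`.
      covered : List Word → List (Word × Word) → List Word
      covered vs []             = []
      covered vs ((u , w) ∷ cs) = filter (λ v → regular⋆? (u ++ v ++ w)) vs ++ covered vs cs

      ∈-covered : ∀ {vs v cs u w} → (u , w) ∈ cs → v ∈ vs → (X ⋆) (u ++ v ++ w) → v ∈ covered vs cs
      ∈-covered (here refl) v∈ z∈ = ∈-++⁺ˡ (∈-filter⁺ _ v∈ z∈)
      ∈-covered {vs} {cs = c ∷ _} (there c∈) v∈ z∈ =
        ∈-++⁺ʳ (filter (λ v → regular⋆? (proj₁ c ++ v ++ proj₂ c)) vs) (∈-covered c∈ v∈ z∈)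

      -- The sum of the inverse weights of `u ++ w`: the factors lost when `v` is replaced by
      -- `u ++ v ++ w`.
      cost : List (Word × Word) → ℕ
      cost []             = 0
      cost ((u , w) ∷ cs) = card ℕ.^ length (u ++ w) + cost cs

      -- The map `sandwich` is injective, multiplies masses by the weight of `u ++ w`, and sends the
      -- filtered words into `star-words (n + K)`.
      mass-filter : ∀ n {K} u w → length u + length w ≤ K →
        mass (filter (λ v → regular⋆? (u ++ v ++ w)) (words< n)) ℚ.≤
        (card ℕ.^ length (u ++ w)) · mass (star-words (n + K))
      mass-filter n {K} u w short = begin
        mass vs                              ≡⟨ ℚ.*-identityˡ (mass vs) ⟨
        1ℚ ℚ.* mass vs                       ≡⟨ cong (ℚ._* mass vs) (weight-inverse (u ++ w)) ⟨
        (q · weight (u ++ w)) ℚ.* mass vs    ≡⟨ ×-assoc-* q (weight (u ++ w)) (mass vs) ⟩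
        q · (weight (u ++ w) ℚ.* mass vs)    ≡⟨ cong (q ·_) (mass-scaled (weight (u ++ w)) sandwich vs weight-sandwich) ⟨
        q · mass (map sandwich vs)           ≤⟨ ·-monoʳ-≤ q (mass-mono sandwiches-unique sandwiches⊆) ⟩
        q · mass (star-words (n + K))        ∎
        where
        open ℚ.≤-Reasoning
        q = card ℕ.^ length (u ++ w)
        sandwich : Word → Word
        sandwich v = u ++ v ++ w
        vs = filter (λ v → regular⋆? (sandwich v)) (words< n)
        weight-sandwich : ∀ v → weight (sandwich v) ≡ weight (u ++ w) ℚ.* weight v
        weight-sandwich v = trans
          (trans (weight-++ u (v ++ w)) (cong (weight u ℚ.*_) (weight-++ v w)))
          (trans (solve 3 (λ x y z → x :* (y :* z) := x :* z :* y) refl (weight u) (weight v) (weight w))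
            (cong (ℚ._* weight v) (sym (weight-++ u w))))
          where open ℚ.+-*-Solver
        length-sandwich : ∀ v → length v < n → length (sandwich v) < n + K
        length-sandwich v v<n = ℕ.≤-trans (s≤s (ℕ.≤-reflexive (trans (length-++ u) (trans
            (cong (length u +_) (length-++ v))
            (solve 3 (λ x y z → x :+ (y :+ z) := y :+ (x :+ z)) refl (length u) (length v) (length w))))))
            (ℕ.+-mono-≤ v<n short)
          where open +-*-Solver
        sandwiches-unique : Unique (map sandwich vs)
        sandwiches-unique = Unique.map⁺ (λ {v} {v′} eq → ++-cancelʳ w v v′ (++-cancelˡ u _ _ eq))
          (Unique.filter⁺ _ (words<-unique n))
        sandwiches⊆ : map sandwich vs ⊆ˡ star-words (n + K)
        sandwiches⊆ z∈ with v , v∈ , refl ← ∈-map⁻ sandwich z∈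
          with v∈′ , z∈⋆ ← ∈-filter⁻ (λ v → regular⋆? (sandwich v)) {xs = words< n} v∈ =
          ∈-filter⁺ regular⋆? (∈-words<⁺ (sandwich v) (length-sandwich v (∈-words<⁻ n v∈′))) z∈⋆

      mass-covered : ∀ n {K} cs → All (λ (u , w) → length u + length w ≤ K) cs →
        mass (covered (words< n) cs) ℚ.≤ cost cs · mass (star-words (n + K))
      mass-covered n []             []             = ℚ.≤-refl
      mass-covered n {K} ((u , w) ∷ cs) (short ∷ shorts) = begin
        mass (filter P? (words< n) ++ covered (words< n) cs)
          ≡⟨ mass-++ (filter P? (words< n)) _ ⟩
        mass (filter P? (words< n)) ℚ.+ mass (covered (words< n) cs)
          ≤⟨ ℚ.+-mono-≤ (mass-filter n u w short) (mass-covered n cs shorts) ⟩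
        q · mass (star-words (n + K)) ℚ.+ cost cs · mass (star-words (n + K))
          ≡⟨ ×-homo-+ (mass (star-words (n + K))) q (cost cs) ⟨
        (q + cost cs) · mass (star-words (n + K)) ∎
        where
        open ℚ.≤-Reasoning
        q = card ℕ.^ length (u ++ w)
        P? = λ v → regular⋆? (u ++ v ++ w)

    -- The words of length below `n` have mass `n`, and by completeness each of them is covered by
    -- one of finitely many contexts.
    complete⇒linear-growth : Complete X →
      ∃₂ λ C K → ∀ n → n · 1ℚ ℚ.≤ C · mass (filter regular⋆? (words< (n + K)))
    -- Each side of a context has length at most `size`, so completing a word lengthens it by at
    -- most `size + size`. Both constants are independent of `n`.
    complete⇒linear-growth complete = cost cs , size + size , λ n → begin
      n · 1ℚ                                        ≡⟨ mass-words< n ⟨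
      mass (words< n)                             ≤⟨ mass-mono (words<-unique n) (words⊆covered n) ⟩
      mass (covered (words< n) cs)                ≤⟨ mass-covered n cs (All.tabulate short) ⟩
      cost cs · mass (star-words (n + (size + size))) ∎
      where
      open ℚ.≤-Reasoning
      cs = cartesianProduct contexts contexts
      words⊆covered : ∀ n → words< n ⊆ˡ covered (words< n) cs
      words⊆covered n {v} v∈ with _ , z∈ , v∣z ← complete v
        with _ , u∈ , _ , w∈ , z′∈ ← context z∈ (Infix⇒Factor v∣z) =
        ∈-covered (∈-cartesianProduct⁺ u∈ w∈) v∈ z′∈
      short : ∀ {c} → c ∈ cs → length (proj₁ c) + length (proj₂ c) ≤ size + size
      short c∈ with u∈ , w∈ ← ∈-cartesianProduct⁻ contexts contexts c∈ =
        ℕ.+-mono-≤ (ℕ.≤-pred (∈-words<⁻ (suc size) u∈)) (ℕ.≤-pred (∈-words<⁻ (suc size) w∈))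

    -- From completeness to measure 1

    star-words⊆powers : Code X → ∀ n →
      filter regular⋆? (words< n) ⊆ˡ powers< (filter regular? (words< n)) n
    star-words⊆powers code n z∈
      with z∈< , xs , xs∈ , refl ← ∈-filter⁻ regular⋆? {xs = words< n} z∈
      with z<n ← ∈-words<⁻ n z∈<
      with count , parts ← length-concat ([]∉code code) xs∈ =
      ∈-powers<⁺ (length xs) (ℕ.≤-<-trans count z<n) (∈-map⁺ concat (∈-tuples⁺
        (All.zipWith (λ {x} (x∈ , x≤) → ∈-filter⁺ regular? (∈-words<⁺ x (ℕ.≤-<-trans x≤ z<n)) x∈)
          (xs∈ , parts))))

    complete⇒measure-1 : Code X → Complete X → HasMeasure X 1ℚ
    complete⇒measure-1 code complete = record
      { upper    = λ _ ws! ws∈ → kraft-mcmillan code ws! ws∈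
      ; approach = approach }
      where
      approach : ∀ ε → 0ℚ ℚ.< ε → ∃ λ ws → Unique ws × All X ws × 1ℚ ℚ.- ε ℚ.< mass ws
      approach ε 0<ε with C , K , growth ← complete⇒linear-growth complete
        -- With `n` fixed such that `C < nε`, the comparison with `1 - ε` concerns one finite list
        -- and is decidable. If it fails, `geometric-bound` gives `mass zs * ε ≤ 1`, and linear
        -- growth then yields `nε ≤ C`.
        with n , C<nε ← archimedean C 0<ε
        with 1ℚ ℚ.- ε ℚ.<? mass (filter regular? (words< (n + K)))
      ... | yes close = _ , Unique.filter⁺ regular? (words<-unique (n + K)) ,
        All.all-filter regular? (words< (n + K)) , close
      ... | no  far   = contradiction (ℚ.<-≤-trans C<nε nε≤C) (ℚ.<-irrefl refl)
        where
        open ℚ.≤-Reasoning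
        ws = filter regular? (words< (n + K))
        zs = filter regular⋆? (words< (n + K))
        0≤ε = ℚ.<⇒≤ 0<ε
        mass+ε≤1 : mass ws ℚ.+ ε ℚ.≤ 1ℚ
        mass+ε≤1 = begin
          mass ws ℚ.+ ε         ≤⟨ ℚ.+-monoˡ-≤ ε (ℚ.≮⇒≥ far) ⟩
          1ℚ ℚ.- ε ℚ.+ ε        ≡⟨ solve 1 (λ e → con 1ℚ :- e :+ e := con 1ℚ) refl ε ⟩
          1ℚ                    ∎
          where open ℚ.+-*-Solver
        mass-zs : mass zs ℚ.* ε ℚ.≤ 1ℚ
        mass-zs = begin
          mass zs ℚ.* ε                            ≡⟨ ℚ.*-comm (mass zs) ε ⟩
          ε ℚ.* mass zs                            ≤⟨ *-monoˡ-≤ 0≤ε (mass-mono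
                                                        (Unique.filter⁺ regular⋆? (words<-unique (n + K)))
                                                        (star-words⊆powers code (n + K))) ⟩
          ε ℚ.* mass (powers< ws (n + K))        ≡⟨ cong (ε ℚ.*_) (mass-powers< ws (n + K)) ⟩
          ε ℚ.* geometric (mass ws) (n + K)        ≤⟨ geometric-bound (0≤mass ws) mass+ε≤1 (n + K) ⟩
          1ℚ                                       ∎
        nε≤C : n · ε ℚ.≤ C · 1ℚ
        nε≤C = begin
          n · ε                    ≡⟨ ·≡·1* n ε ⟩
          n · 1ℚ ℚ.* ε             ≤⟨ ℚ.*-monoʳ-≤-nonNeg ε {{ℚ.nonNegative 0≤ε}} (growth n) ⟩
          (C · mass zs) ℚ.* ε      ≡⟨ ×-assoc-* C (mass zs) ε ⟩
          C · (mass zs ℚ.* ε)      ≤⟨ ·-monoʳ-≤ C mass-zs ⟩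
          C · 1ℚ                   ∎

proposition3p12 : ∀ (𝒜 : Alphabet) → let open Words 𝒜 in
    ∀ (k : ℕ) → 1 ≤ k →
    ∀ (X : Language) → Regular X → IndependentCode (𝒫̲ k) X →
    (MaximalIn (IndependentCode (𝒫̲ k)) X ⇔ MaximalCode X)
    × (MaximalCode X ⇔ Complete X)
    × (Complete X ⇔ HasMeasure X 1ℚ)
proposition3p12 𝒜 k 1≤k X regular ind@(code , _) =
  -- Each of (i) and (ii) gives (iii), and the way back to (ii) leads through (iv).
  mk⇔ (complete⇒maximal ∘ maximal⇒complete 𝒜 regular id ind)
      -- An independent code containing `X` is in particular a code containing `X`, so maximality
      -- passes to the smaller family.
      (λ (_ , maximal) → ind , λ Y (Y-code , _) → maximal Y Y-code) ,
  mk⇔ maximalCode⇒complete complete⇒maximal ,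
  mk⇔ complete⇒measure (maximalCode⇒complete ∘ measure⇒maximal)
  where
  open Words 𝒜
  measure⇒maximal : HasMeasure X 1ℚ → MaximalCode X
  measure⇒maximal = measure-1⇒maximal 𝒜 (regular? 𝒜 regular) code
  complete⇒measure : Complete X → HasMeasure X 1ℚ
  complete⇒measure = complete⇒measure-1 𝒜 regular code
  complete⇒maximal : Complete X → MaximalCode X
  complete⇒maximal = measure⇒maximal ∘ complete⇒measure
  maximalCode⇒complete : MaximalCode X → Complete X
  maximalCode⇒complete = maximal⇒complete 𝒜 regular proj₁ ind
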